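{- Let $a_1,\dots,a_n$ be positive integers, not both $n=1$ and $a_1=1$, and let $[a_1,\dots,a_n]=p/q$ with $p,q$ relatively prime positive integers. Then \[ [a_1,\dots,a_{n-1},a_n+1,a_n-1,a_{n-1},\dots,a_1]=\frac{p^2}{pq+(-1)^n}. \]
   Context: $[b_1,\dots,b_k]=b_1+\cfrac{1}{b_2+\cfrac{1}{\ddots+\cfrac{1}{b_k}}}$ denotes a continued fraction. An entry $0$ in the interior of a continued fraction is interpreted via $[\dots,a,0,b,\dots]=[\dots,a+b,\dots]$ (this occurs when $a_n=1$). -}

module Defs where

open import Data.Nat.Base using (ℕ; _+_)
open import Data.Integer.Base using (ℤ; +_)
open import Data.List.Base using (List; []; _∷_)
open import Data.Maybe.Base using (Maybe; just; nothing; map; _>>=_)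
open import Data.Rational.Base as ℚ using (ℚ; 0ℚ; 1/_; _/_; ≢-nonZero)
open import Data.Rational.Properties using (_≟_)
open import Relation.Nullary.Decidable using (yes; no)

fromℤ : ℤ → ℚ
fromℤ i = i / 1

reciprocal : ℚ → Maybe ℚ
reciprocal r with r ≟ 0ℚ
... | yes _   = nothing
... | no  r≢0 = just ((1/ r) {{≢-nonZero r≢0}})

-- contFrac b₁ (b₂ ∷ … ∷ bₖ ∷ []) is the value of [b₁, b₂, …, bₖ], and is
-- nothing when the evaluation divides by zero.  The second clause is the
-- convention [a, 0, b, …] = [a + b, …] for an interior entry 0; a final
-- entry 0, as in [a, 0], is not interior and does lead to nothing.
contFrac : ℕ → List ℕ → Maybe ℚ
contFrac b []           = just (fromℤ (+ b))
contFrac a (0 ∷ b ∷ bs) = contFrac (a + b) bs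
contFrac b (c ∷ bs)     = map (fromℤ (+ b) ℚ.+_) (contFrac c bs >>= reciprocal)

-- The empty continued fraction has no value.
[_]ᶜᶠ : List ℕ → Maybe ℚ
[ []     ]ᶜᶠ = nothing
[ b ∷ bs ]ᶜᶠ = contFrac b bs

{-# OPTIONS --safe #-}
-- Let A = (a 1 ; 1 0) be the matrix of an entry a, and let M = (r s ; t u) be
-- the product of the matrices of a₁, …, aₙ₋₁.  The first column of a product of
-- entry matrices is the numerator and denominator of the continued fraction,
-- and reversing the entries transposes the product.  With a = aₙ the palindromic
-- fraction has as first column that of M · (a² , a+1 ; a-1 , 1) · Mᵀ, namely
-- (ra + s)² = p² over (ra + s)(ta + u) + st − ru = pq − det M, and
-- det M = (-1)ⁿ⁻¹.
module Submission where

open import Data.Nat.Base using (ℕ; _+_; _∸_; _<_; NonZero)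
open import Data.Nat.Coprimality using (Coprime)
open import Data.Integer.Base as ℤ using (+_; -1ℤ)
open import Data.Rational.Base as ℚ using (_/_; _÷_)
open import Data.List.Base using (List; _∷_; _∷ʳ_; _++_; length; reverse)
open import Data.List.Relation.Unary.All using (All)
open import Data.Maybe.Base using (just)
open import Data.Product.Base using (Σ-syntax; _×_)
open import Relation.Nullary.Negation.Core using (¬_)
open import Relation.Binary.PropositionalEquality.Core using (_≡_)
open import Defs

import Algebra.Properties.AbelianGroup
open import Data.Integer.Base using (ℤ)
import Data.Integer.Properties as ℤ
import Data.Integer.Tactic.RingSolver as ℤ-Solver
open import Data.List.Base using ([]; foldr)
open import Data.List.Properties
  using (foldr-++; foldr-∷ʳ; length-++; unfold-reverse; reverse-injective)
open import Data.List.Relation.Unary.All as All using ([]; _∷_)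
open import Data.List.Relation.Unary.All.Properties using (++⁻ˡ; ++⁻ʳ; ∷ʳ⁺)
open import Data.Maybe.Base as Maybe using (_>>=_)
open import Data.Maybe.Properties using (just-injective)
open import Data.Nat.Base using (suc; _*_; z<s; >-nonZero)
open import Data.Nat.Coprimality as Coprimality using (coprime-divisor)
open import Data.Nat.Divisibility using (divides; ∣-antisym; ∣1⇒≡1; ∣m+n∣m⇒∣n; ∣n⇒∣m*n)
import Data.Nat.Properties as ℕ
import Data.Nat.Tactic.RingSolver as ℕ-Solver
open import Data.Product.Base using (_,_; proj₁; proj₂; ∃-syntax)
open import Data.Rational.Base using (ℚ; 0ℚ; 1ℚ; 1/_; toℚᵘ; ≢-nonZero)
import Data.Rational.Properties as ℚ
open import Data.Rational.Unnormalised.Base as ℚᵘ using (mkℚᵘ; *≡*)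
import Data.Rational.Unnormalised.Properties as ℚᵘ
open import Function.Base using (_∘_)
open import Relation.Binary.PropositionalEquality
  using (_≢_; refl; sym; trans; cong; cong₂; subst; module ≡-Reasoning)
open import Relation.Nullary.Decidable using (yes; no)
open import Relation.Nullary.Negation.Core using (contradiction)

private module ℤ-+ = Algebra.Properties.AbelianGroup ℤ.+-0-abelianGroup

-- Rational arithmetic

toℚᵘ-fromℤ : ∀ i → toℚᵘ (fromℤ i) ℚᵘ.≃ mkℚᵘ i 0
toℚᵘ-fromℤ i = ℚ.toℚᵘ-fromℚᵘ (mkℚᵘ i 0)

fromℤ-homo-+ : ∀ i j → fromℤ (i ℤ.+ j) ≡ fromℤ i ℚ.+ fromℤ j
fromℤ-homo-+ i j = ℚ.toℚᵘ-injective (begin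
  toℚᵘ (fromℤ (i ℤ.+ j))                ≈⟨ toℚᵘ-fromℤ (i ℤ.+ j) ⟩
  mkℚᵘ (i ℤ.+ j) 0                      ≈⟨ *≡* (over-one i j) ⟩
  mkℚᵘ i 0 ℚᵘ.+ mkℚᵘ j 0                ≈⟨ ℚᵘ.+-cong (toℚᵘ-fromℤ i) (toℚᵘ-fromℤ j) ⟨
  toℚᵘ (fromℤ i) ℚᵘ.+ toℚᵘ (fromℤ j)    ≈⟨ ℚ.toℚᵘ-homo-+ (fromℤ i) (fromℤ j) ⟨
  toℚᵘ (fromℤ i ℚ.+ fromℤ j)            ∎)
  where
  open ℚᵘ.≃-Reasoning
  over-one : ∀ i j → (i ℤ.+ j) ℤ.* + 1 ≡ (i ℤ.* + 1 ℤ.+ j ℤ.* + 1) ℤ.* + 1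
  over-one = ℤ-Solver.solve-∀

fromℤ-homo-* : ∀ i j → fromℤ (i ℤ.* j) ≡ fromℤ i ℚ.* fromℤ j
fromℤ-homo-* i j = ℚ.toℚᵘ-injective (begin
  toℚᵘ (fromℤ (i ℤ.* j))                ≈⟨ toℚᵘ-fromℤ (i ℤ.* j) ⟩
  mkℚᵘ i 0 ℚᵘ.* mkℚᵘ j 0                ≈⟨ ℚᵘ.*-cong (toℚᵘ-fromℤ i) (toℚᵘ-fromℤ j) ⟨
  toℚᵘ (fromℤ i) ℚᵘ.* toℚᵘ (fromℤ j)    ≈⟨ ℚ.toℚᵘ-homo-* (fromℤ i) (fromℤ j) ⟨
  toℚᵘ (fromℤ i ℚ.* fromℤ j)            ∎)
  where open ℚᵘ.≃-Reasoning

fromℤ-injective : ∀ {i j} → fromℤ i ≡ fromℤ j → i ≡ j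
fromℤ-injective {i} {j} eq with ℚ./-injective-≃ (mkℚᵘ i 0) (mkℚᵘ j 0) eq
... | *≡* i*1≡j*1 = trans (sym (ℤ.*-identityʳ i)) (trans i*1≡j*1 (ℤ.*-identityʳ j))

i/n*n≡i : ∀ i n .{{_ : NonZero n}} → i / n ℚ.* fromℤ (+ n) ≡ fromℤ i
i/n*n≡i i n@(suc n-1) = ℚ.toℚᵘ-injective (begin
  toℚᵘ (i / n ℚ.* fromℤ (+ n))            ≈⟨ ℚ.toℚᵘ-homo-* (i / n) (fromℤ (+ n)) ⟩
  toℚᵘ (i / n) ℚᵘ.* toℚᵘ (fromℤ (+ n))
    ≈⟨ ℚᵘ.*-cong (ℚ.toℚᵘ-fromℚᵘ (mkℚᵘ i n-1)) (toℚᵘ-fromℤ (+ n)) ⟩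
  mkℚᵘ i n-1 ℚᵘ.* mkℚᵘ (+ n) 0
    ≈⟨ *≡* (trans (ℤ.*-identityʳ (i ℤ.* + n))
                  (cong (λ k → i ℤ.* + k) (sym (ℕ.*-identityʳ n)))) ⟩
  mkℚᵘ i 0                                ≈⟨ toℚᵘ-fromℤ i ⟨
  toℚᵘ (fromℤ i)                          ∎)
  where open ℚᵘ.≃-Reasoning

r*y≡x⇒r≡x÷y : ∀ {r x y} .{{_ : ℚ.NonZero y}} → r ℚ.* y ≡ x → r ≡ x ÷ y
r*y≡x⇒r≡x÷y {r} {x} {y} eq = begin
  r                      ≡⟨ ℚ.*-identityʳ r ⟨
  r ℚ.* 1ℚ               ≡⟨ cong (r ℚ.*_) (ℚ.*-inverseʳ y) ⟨
  r ℚ.* (y ℚ.* 1/ y)     ≡⟨ ℚ.*-assoc r y (1/ y) ⟨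
  (r ℚ.* y) ℚ.* 1/ y     ≡⟨ cong (ℚ._* 1/ y) eq ⟩
  x ÷ y                  ∎
  where open ≡-Reasoning

-- Characterising the reciprocal by a product keeps `1/_` and its instance argument out of later
-- calculations.
reciprocal-≢0 : ∀ {r} → r ≢ 0ℚ → ∃[ s ] reciprocal r ≡ just s × s ℚ.* r ≡ 1ℚ
reciprocal-≢0 {r} r≢0 with r ℚ.≟ 0ℚ
... | yes r≡0  = contradiction r≡0 r≢0
... | no  r≢0′ = _ , refl , ℚ.*-inverseˡ r {{≢-nonZero r≢0′}}

fromℕ : ℕ → ℚ
fromℕ n = fromℤ (+ n)

fromℕ-homo-+ : ∀ m n → fromℕ (m + n) ≡ fromℕ m ℚ.+ fromℕ n
fromℕ-homo-+ m n = fromℤ-homo-+ (+ m) (+ n)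

fromℕ-homo-* : ∀ m n → fromℕ (m * n) ≡ fromℕ m ℚ.* fromℕ n
fromℕ-homo-* m n = trans (cong fromℤ (ℤ.pos-* m n)) (fromℤ-homo-* (+ m) (+ n))

fromℕ-injective : ∀ {m n} → fromℕ m ≡ fromℕ n → m ≡ n
fromℕ-injective = ℤ.+-injective ∘ fromℤ-injective

fromℕ-≢0 : ∀ n .{{_ : NonZero n}} → fromℕ n ≢ 0ℚ
fromℕ-≢0 (suc n) eq with () ← fromℕ-injective {suc n} {0} eq

-- Products of the matrices of the entries

-- step b is multiplication by the matrix (b 1 ; 1 0).
step : ℕ → ℕ × ℕ → ℕ × ℕ
step b (x , y) = b * x + y , x

act : List ℕ → ℕ × ℕ → ℕ × ℕ
act bs v = foldr step v bs

-- (num bs  num′ bs ; den bs  den′ bs) is the product of the matrices.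
num den num′ den′ : List ℕ → ℕ
num  bs = proj₁ (act bs (1 , 0))
den  bs = proj₂ (act bs (1 , 0))
num′ bs = proj₁ (act bs (0 , 1))
den′ bs = proj₂ (act bs (0 , 1))

-- Each `step b` is linear, so the images of the two unit vectors, which are the columns of the
-- product, determine `act bs`.
act-linear : ∀ bs x y →
  act bs (x , y) ≡ (num bs * x + num′ bs * y , den bs * x + den′ bs * y)
act-linear []       x y = cong₂ _,_ (first x y) (second x y)
  where
  first : ∀ x y → x ≡ 1 * x + 0 * y
  first = ℕ-Solver.solve-∀
  second : ∀ x y → y ≡ 0 * x + 1 * y
  second = ℕ-Solver.solve-∀
act-linear (b ∷ bs) x y = trans (cong (step b) (act-linear bs x y))
  (cong (_, num bs * x + num′ bs * y) (regroup b (num bs) (den bs) (num′ bs) (den′ bs) x y))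
  where
  regroup : ∀ b r t s u x y →
    b * (r * x + s * y) + (t * x + u * y) ≡ (b * r + t) * x + (b * s + u) * y
  regroup = ℕ-Solver.solve-∀

-- Entry matrices are symmetric, so reversing their product transposes it: `den` and `num′` trade
-- places. The vector stays general because the entry moved to the end acts on it first.
act-reverse : ∀ bs x y →
  act (reverse bs) (x , y) ≡ (num bs * x + den bs * y , num′ bs * x + den′ bs * y)
act-reverse []       x y = act-linear [] x y
act-reverse (b ∷ bs) x y = begin
  act (reverse (b ∷ bs)) (x , y)       ≡⟨ cong (λ cs → act cs (x , y)) (unfold-reverse b bs) ⟩
  act (reverse bs ∷ʳ b) (x , y)        ≡⟨ foldr-∷ʳ step (x , y) b (reverse bs) ⟩
  act (reverse bs) (b * x + y , x)     ≡⟨ act-reverse bs (b * x + y) x ⟩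
  _                                    ≡⟨ cong₂ _,_ (regroup b (num bs) (den bs) x y)
                                                    (regroup b (num′ bs) (den′ bs) x y) ⟩
  _                                    ∎
  where
  open ≡-Reasoning
  regroup : ∀ b r t x y → r * (b * x + y) + t * x ≡ (b * r + t) * x + r * y
  regroup = ℕ-Solver.solve-∀

pos-step : ∀ b x y → + (b * x + y) ≡ + b ℤ.* + x ℤ.+ + y
pos-step b x y = cong (ℤ._+ + y) (ℤ.pos-* b x)

-- Every entry matrix has determinant -1, and determinants multiply.
determinant : ∀ bs →
  + num bs ℤ.* + den′ bs ≡ + num′ bs ℤ.* + den bs ℤ.+ -1ℤ ℤ.^ length bs
determinant []       = refl
determinant (b ∷ bs) = begin
  + (b * num bs + den bs) ℤ.* s            ≡⟨ cong (ℤ._* s) (pos-step b (num bs) (den bs)) ⟩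
  -- Inserting `ε` and its negative produces `s * t + ε`, the right side of the induction
  -- hypothesis.
  (+ b ℤ.* r ℤ.+ t) ℤ.* s                  ≡⟨ expand (+ b) r s t ε ⟩
  + b ℤ.* s ℤ.* r ℤ.+ (s ℤ.* t ℤ.+ ε) ℤ.+ -1ℤ ℤ.* ε
    ≡⟨ cong (λ i → + b ℤ.* s ℤ.* r ℤ.+ i ℤ.+ -1ℤ ℤ.* ε) (determinant bs) ⟨
  + b ℤ.* s ℤ.* r ℤ.+ r ℤ.* u ℤ.+ -1ℤ ℤ.* ε
    ≡⟨ collect (+ b) r s u (-1ℤ ℤ.* ε) ⟩
  (+ b ℤ.* s ℤ.+ u) ℤ.* r ℤ.+ -1ℤ ℤ.* ε
    ≡⟨ cong (λ i → i ℤ.* r ℤ.+ -1ℤ ℤ.* ε) (pos-step b (num′ bs) (den′ bs)) ⟨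
  + (b * num′ bs + den′ bs) ℤ.* r ℤ.+ -1ℤ ℤ.* ε ∎
  where
  open ≡-Reasoning
  r s t u ε : ℤ
  r = + num bs
  s = + num′ bs
  t = + den bs
  u = + den′ bs
  ε = -1ℤ ℤ.^ length bs
  expand : ∀ b r s t ε →
    (b ℤ.* r ℤ.+ t) ℤ.* s ≡ b ℤ.* s ℤ.* r ℤ.+ (s ℤ.* t ℤ.+ ε) ℤ.+ -1ℤ ℤ.* ε
  expand = ℤ-Solver.solve-∀
  collect : ∀ b r s u δ →
    b ℤ.* s ℤ.* r ℤ.+ r ℤ.* u ℤ.+ δ ≡ (b ℤ.* s ℤ.+ u) ℤ.* r ℤ.+ δ
  collect = ℤ-Solver.solve-∀

-- Euclid's step: a common divisor of `b * x + y` and `x` also divides `y`.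
num-den-coprime : ∀ bs → Coprime (num bs) (den bs)
num-den-coprime []       (d∣1 , _)          = ∣1⇒≡1 d∣1
num-den-coprime (b ∷ bs) (d∣bx+y , d∣x) =
  num-den-coprime bs (d∣x , ∣m+n∣m⇒∣n d∣bx+y (∣n⇒∣m*n b d∣x))

-- Uniqueness of lowest terms: by coprimality `p` and `x` divide each other.
cross-coprime-≡ : ∀ {p q x y} → Coprime p q → Coprime x y → p * y ≡ x * q → p ≡ x
cross-coprime-≡ {p} {q} {x} {y} p⊥q x⊥y py≡xq = ∣-antisym
  (coprime-divisor p⊥q (divides y (trans (ℕ.*-comm q x) (trans (sym py≡xq) (ℕ.*-comm p y)))))
  (coprime-divisor x⊥y (divides q (trans (ℕ.*-comm y p) (trans py≡xq (ℕ.*-comm x q)))))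

-- Evaluation of continued fractions

-- The tails whose evaluation by contFrac never divides by zero.
data Regular : List ℕ → Set where
  []   : Regular []
  _∷_  : ∀ {b bs} → 0 < b → Regular bs → Regular (b ∷ bs)
  0∷_  : ∀ {b bs} → Regular bs → Regular (0 ∷ b ∷ bs)

All-pos⇒Regular-++ : ∀ {as bs} → All (0 <_) as → Regular bs → Regular (as ++ bs)
All-pos⇒Regular-++ []            bs-reg = bs-reg
All-pos⇒Regular-++ (a>0 ∷ as>0)  bs-reg = a>0 ∷ All-pos⇒Regular-++ as>0 bs-reg

All-pos⇒Regular : ∀ {as} → All (0 <_) as → Regular as
All-pos⇒Regular []           = []
All-pos⇒Regular (a>0 ∷ as>0) = a>0 ∷ All-pos⇒Regular as>0

num-pos : ∀ {bs} → Regular bs → 0 < num bs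
num-pos []                       = z<s
num-pos (_∷_ {suc b} {bs} _ reg) =
  ℕ.<-≤-trans (num-pos reg) (ℕ.≤-trans (ℕ.m≤m+n (num bs) (b * num bs)) (ℕ.m≤m+n _ (den bs)))
-- `num (0 ∷ b ∷ bs)` computes to `num bs`.
num-pos (0∷ reg)                 = num-pos reg

-- Links evaluation by `contFrac` to the matrix product. The product form of the last field avoids
-- dividing by `den bs`.
record Value (bs : List ℕ) : Set where
  field
    value         : ℚ
    []ᶜᶠ≡value    : [ bs ]ᶜᶠ ≡ just value
    value*den≡num : value ℚ.* fromℕ (den bs) ≡ fromℕ (num bs)

open Value

value-singleton : ∀ b → Value (b ∷ [])
value-singleton b = record
  { value         = fromℕ b
  ; []ᶜᶠ≡value    = refl
  ; value*den≡num = trans (sym (fromℕ-homo-* b 1)) (cong fromℕ (sym (ℕ.+-identityʳ (b * 1))))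
  }

-- The convention for an interior 0 agrees with the matrices: those of `b`, `0`, `c` multiply to
-- that of `b + c`.
value-merge : ∀ {b c bs} → Value (b + c ∷ bs) → Value (b ∷ 0 ∷ c ∷ bs)
value-merge {b} {c} {bs} v = record
  { value         = value v
  ; []ᶜᶠ≡value    = []ᶜᶠ≡value v
  ; value*den≡num = trans (value*den≡num v) (cong fromℕ (regroup b c (num bs) (den bs)))
  }
  where
  regroup : ∀ b c x y → (b + c) * x + y ≡ b * x + (c * x + y)
  regroup = ℕ-Solver.solve-∀

r≡x/y⇒b+1/r≡[bx+y]/x : ∀ b x y r s → r ℚ.* fromℕ y ≡ fromℕ x → s ℚ.* r ≡ 1ℚ →
  (fromℕ b ℚ.+ s) ℚ.* fromℕ x ≡ fromℕ (b * x + y)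
r≡x/y⇒b+1/r≡[bx+y]/x b x y r s ry≡x sr≡1 = begin
  (fromℕ b ℚ.+ s) ℚ.* fromℕ x                     ≡⟨ ℚ.*-distribʳ-+ (fromℕ x) (fromℕ b) s ⟩
  fromℕ b ℚ.* fromℕ x ℚ.+ s ℚ.* fromℕ x           ≡⟨ cong₂ ℚ._+_ (sym (fromℕ-homo-* b x)) sx≡y ⟩
  fromℕ (b * x) ℚ.+ fromℕ y                       ≡⟨ fromℕ-homo-+ (b * x) y ⟨
  fromℕ (b * x + y)                               ∎
  where
  open ≡-Reasoning
  sx≡y : s ℚ.* fromℕ x ≡ fromℕ y
  sx≡y = begin
    s ℚ.* fromℕ x            ≡⟨ cong (s ℚ.*_) ry≡x ⟨
    s ℚ.* (r ℚ.* fromℕ y)    ≡⟨ ℚ.*-assoc s r (fromℕ y) ⟨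
    (s ℚ.* r) ℚ.* fromℕ y    ≡⟨ cong (ℚ._* fromℕ y) sr≡1 ⟩
    1ℚ ℚ.* fromℕ y           ≡⟨ ℚ.*-identityˡ (fromℕ y) ⟩
    fromℕ y                  ∎

value-∷ : ∀ b {c bs} → 0 < c → 0 < num (c ∷ bs) → Value (c ∷ bs) → Value (b ∷ c ∷ bs)
-- With `c` a successor, `contFrac b (c ∷ bs)` reduces by its last clause.
value-∷ b {c@(suc _)} {bs} _ num>0 v = record
  { value         = fromℕ b ℚ.+ s
  ; []ᶜᶠ≡value    = cong (Maybe.map (fromℕ b ℚ.+_))
                      (trans (cong (_>>= reciprocal) ([]ᶜᶠ≡value v)) recip≡s)
  ; value*den≡num =
      r≡x/y⇒b+1/r≡[bx+y]/x b (num (c ∷ bs)) (num bs) (value v) s (value*den≡num v) sr≡1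
  }
  where
  value≢0 : value v ≢ 0ℚ
  value≢0 v≡0 = fromℕ-≢0 (num (c ∷ bs)) {{>-nonZero num>0}}
    (trans (sym (value*den≡num v))
      (trans (cong (ℚ._* fromℕ (num bs)) v≡0) (ℚ.*-zeroˡ (fromℕ (num bs)))))
  inverse : ∃[ s ] reciprocal (value v) ≡ just s × s ℚ.* value v ≡ 1ℚ
  inverse = reciprocal-≢0 value≢0
  s : ℚ
  s = proj₁ inverse
  recip≡s : reciprocal (value v) ≡ just s
  recip≡s = proj₁ (proj₂ inverse)
  sr≡1 : s ℚ.* value v ≡ 1ℚ
  sr≡1 = proj₂ (proj₂ inverse)

regular⇒value : ∀ b {bs} → Regular bs → Value (b ∷ bs)
regular⇒value b []              = value-singleton b
regular⇒value b (c>0 ∷ reg)     = value-∷ b c>0 (num-pos (c>0 ∷ reg)) (regular⇒value _ reg)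
regular⇒value b (0∷_ {c} reg)   = value-merge (regular⇒value (b + c) reg)

-- `Regular` concerns only what follows the leading entry, so the cases differ by whether that entry
-- is `b` or the head of `as`.
++-value : ∀ {as b bs} → All (0 <_) as → 0 < b → Regular bs → Value (as ++ b ∷ bs)
++-value []                  _   reg = regular⇒value _ reg
++-value (_ ∷ as>0)          b>0 reg = regular⇒value _ (All-pos⇒Regular-++ as>0 (b>0 ∷ reg))

-- The denominator of a nonempty list is by definition the numerator of its tail.
++-den-pos : ∀ {as b bs} → All (0 <_) as → 0 < b → Regular bs → 0 < den (as ++ b ∷ bs)
++-den-pos []         _   reg = num-pos reg
++-den-pos (_ ∷ as>0) b>0 reg = num-pos (All-pos⇒Regular-++ as>0 (b>0 ∷ reg))

-- The palindromic fraction

act-∷ʳ : ∀ as a →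
  act (as ∷ʳ a) (1 , 0) ≡ (num as * a + num′ as , den as * a + den′ as)
act-∷ʳ as a = begin
  act (as ∷ʳ a) (1 , 0)         ≡⟨ foldr-∷ʳ step (1 , 0) a as ⟩
  act as (a * 1 + 0 , 1)        ≡⟨ act-linear as (a * 1 + 0) 1 ⟩
  _                             ≡⟨ cong₂ _,_ (simplify (num as) (num′ as) a)
                                             (simplify (den as) (den′ as) a) ⟩
  _                             ∎
  where
  open ≡-Reasoning
  simplify : ∀ r s a → r * (a * 1 + 0) + s * 1 ≡ r * a + s
  simplify = ℕ-Solver.solve-∀

palindrome : List ℕ → ℕ → List ℕ
palindrome as a = as ++ (a + 1) ∷ (a ∸ 1) ∷ reverse as

-- The reversed block sends `(1 , 0)` to the first row `(r , s)` of M; the two middle entries act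
-- next. Writing the last entry as `suc a` turns `suc a ∸ 1` into `a`.
act-palindrome : ∀ as a → let r = num as; s = num′ as; v = a * r + s in
  act (palindrome as (suc a)) (1 , 0) ≡ act as ((suc a + 1) * v + r , v)
act-palindrome as a = begin
  act (palindrome as (suc a)) (1 , 0)
    ≡⟨ foldr-++ step (1 , 0) as _ ⟩
  act as (act ((suc a + 1) ∷ a ∷ []) (act (reverse as) (1 , 0)))
    ≡⟨ cong (λ v → act as (act ((suc a + 1) ∷ a ∷ []) v)) (act-reverse as 1 0) ⟩
  _ ≡⟨ cong₂ (λ x y → act as (act ((suc a + 1) ∷ a ∷ []) (x , y)))
             (simplify (num as) (den as)) (simplify (num′ as) (den′ as)) ⟩
  _ ∎
  where
  open ≡-Reasoning
  simplify : ∀ x y → x * 1 + y * 0 ≡ x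
  simplify = ℕ-Solver.solve-∀

num-palindrome : ∀ as {a} → 0 < a → let p = num (as ∷ʳ a) in num (palindrome as a) ≡ p * p
num-palindrome as {suc a} _ = begin
  num (palindrome as (suc a))     ≡⟨ cong proj₁ (act-palindrome as a) ⟩
  proj₁ (act as _)                ≡⟨ cong proj₁ (act-linear as _ _) ⟩
  _                               ≡⟨ square a (num as) (num′ as) ⟩
  p * p                           ≡⟨ cong (λ x → x * x) (cong proj₁ (act-∷ʳ as (suc a))) ⟨
  num (as ∷ʳ suc a) * num (as ∷ʳ suc a) ∎
  where
  open ≡-Reasoning
  p : ℕ
  p = num as * suc a + num′ as
  -- Here `v` is `p - r`, which makes the left side collapse to `p * p`.
  square : ∀ a r s → let p = r * suc a + s; v = a * r + s in
    r * ((suc a + 1) * v + r) + s * v ≡ p * p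
  square = ℕ-Solver.solve-∀

den-palindrome : ∀ as {a} → 0 < a → let p = num (as ∷ʳ a); q = den (as ∷ʳ a) in
  + den (palindrome as a) ≡ + p ℤ.* + q ℤ.+ -1ℤ ℤ.^ length (as ∷ʳ a)
-- Adding `r * u` to both sides keeps `product` free of subtraction; `determinant` then trades it
-- for `s * t + ε`.
den-palindrome as {suc a} _ = ℤ-+.∙-cancelʳ (+ (r * u)) _ _ (begin
  + (den (palindrome as (suc a)) + r * u)
    ≡⟨ cong (λ v → + (proj₂ v + r * u))
            (trans (act-palindrome as a) (act-linear as _ _)) ⟩
  + (t * ((suc a + 1) * (a * r + s) + r) + u * (a * r + s) + r * u)
    ≡⟨ cong +_ (product a r s t u) ⟩
  + ((r * suc a + s) * (t * suc a + u) + s * t)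
    ≡⟨ cong (λ v → + (proj₁ v * proj₂ v + s * t)) (act-∷ʳ as (suc a)) ⟨
  + (p * q + s * t)
    ≡⟨ cong₂ ℤ._+_ (ℤ.pos-* p q) (ℤ.pos-* s t) ⟩
  + p ℤ.* + q ℤ.+ + s ℤ.* + t
    ≡⟨ cancel (+ p ℤ.* + q) (+ s ℤ.* + t) ε ⟩
  + p ℤ.* + q ℤ.+ -1ℤ ℤ.* ε ℤ.+ (+ s ℤ.* + t ℤ.+ ε)
    ≡⟨ cong₂ (λ n i → + p ℤ.* + q ℤ.+ -1ℤ ℤ.^ n ℤ.+ i) |as∷ʳa| (determinant as) ⟨
  + p ℤ.* + q ℤ.+ -1ℤ ℤ.^ length (as ∷ʳ suc a) ℤ.+ + r ℤ.* + u
    ≡⟨ cong (λ i → + p ℤ.* + q ℤ.+ -1ℤ ℤ.^ length (as ∷ʳ suc a) ℤ.+ i) (ℤ.pos-* r u) ⟨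
  + p ℤ.* + q ℤ.+ -1ℤ ℤ.^ length (as ∷ʳ suc a) ℤ.+ + (r * u) ∎)
  where
  open ≡-Reasoning
  p q r s t u : ℕ
  p = num (as ∷ʳ suc a)
  q = den (as ∷ʳ suc a)
  r = num as
  s = num′ as
  t = den as
  u = den′ as
  ε : ℤ
  ε = -1ℤ ℤ.^ length as
  -- The one extra entry turns the sign `ε` of M into `-1ℤ * ε`.
  |as∷ʳa| : length (as ∷ʳ suc a) ≡ suc (length as)
  |as∷ʳa| = trans (length-++ as) (ℕ.+-comm (length as) 1)
  product : ∀ a r s t u → let v = a * r + s in
    t * ((suc a + 1) * v + r) + u * v + r * u ≡ (r * suc a + s) * (t * suc a + u) + s * t
  product = ℕ-Solver.solve-∀
  cancel : ∀ x y ε → x ℤ.+ y ≡ x ℤ.+ -1ℤ ℤ.* ε ℤ.+ (y ℤ.+ ε)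
  cancel = ℤ-Solver.solve-∀

All-pos-reverse : ∀ {as} → All (0 <_) as → All (0 <_) (reverse as)
All-pos-reverse [] = []
All-pos-reverse {a ∷ as} (a>0 ∷ as>0) =
  subst (All (0 <_)) (sym (unfold-reverse a as)) (∷ʳ⁺ (All-pos-reverse as>0) a>0)

-- Only `a = 1` creates a 0. It is interior as soon as `as` is nonempty, which is what excluding the
-- list of a single 1 guarantees.
palindrome-tail-regular : ∀ as a → All (0 <_) as → 0 < a →
  ¬ (length (as ∷ʳ a) ≡ 1 × a ≡ 1) → Regular ((a ∸ 1) ∷ reverse as)
palindrome-tail-regular as (suc (suc _)) as>0 _ _   = z<s ∷ All-pos⇒Regular (All-pos-reverse as>0)
palindrome-tail-regular as 1             as>0 _ ≢[1]
  with reverse as in eq | All-pos-reverse as>0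
... | []    | _        = contradiction
  (cong (length ∘ (_∷ʳ 1)) (reverse-injective {x = as} {y = []} eq) , refl) ≢[1]
... | _ ∷ _ | _ ∷ rev>0 = 0∷ All-pos⇒Regular rev>0

theorem3p18 : (as : List ℕ) (aₙ : ℕ) →
    let n = length (as ∷ʳ aₙ) in
    All (0 <_) (as ∷ʳ aₙ) →
    ¬ (n ≡ 1 × aₙ ≡ 1) →
    (p q : ℕ) .{{_ : NonZero p}} .{{_ : NonZero q}} →
    Coprime p q →
    [ as ∷ʳ aₙ ]ᶜᶠ ≡ just (+ p / q) →
    let d = fromℤ (+ p ℤ.* + q ℤ.+ -1ℤ ℤ.^ n) in
    Σ[ d≢0 ∈ ℚ.NonZero d ]
    [ as ++ (aₙ + 1) ∷ (aₙ ∸ 1) ∷ reverse as ]ᶜᶠ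
    ≡ just (_÷_ (fromℤ ((+ p) ℤ.^ 2)) d {{d≢0}})
theorem3p18 as a as∷ʳa>0 ≢[1] p q p⊥q as∷ʳa≡p/q =
  d≢0 , trans ([]ᶜᶠ≡value w) (cong just (r*y≡x⇒r≡x÷y {{d≢0}} w*d≡p²))
  where
  as>0 : All (0 <_) as
  as>0 = ++⁻ˡ as as∷ʳa>0
  a>0 : 0 < a
  a>0 = All.head (++⁻ʳ as as∷ʳa>0)
  a+1>0 : 0 < a + 1
  a+1>0 = ℕ.<-≤-trans a>0 (ℕ.m≤m+n a 1)
  tail-regular : Regular ((a ∸ 1) ∷ reverse as)
  tail-regular = palindrome-tail-regular as a as>0 a>0 ≢[1]
  v : Value (as ∷ʳ a)
  v = ++-value as>0 a>0 []
  w : Value (palindrome as a)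
  w = ++-value as>0 a+1>0 tail-regular
  x y : ℕ
  x = num (as ∷ʳ a)
  y = den (as ∷ʳ a)
  -- Both fractions are values of the same list; comparing lowest terms then gives `x ≡ p` and
  -- `y ≡ q`.
  xq≡py : x * q ≡ p * y
  xq≡py = fromℕ-injective (begin
    fromℕ (x * q)                           ≡⟨ fromℕ-homo-* x q ⟩
    fromℕ x ℚ.* fromℕ q                     ≡⟨ cong (ℚ._* fromℕ q) x≡p/q*y ⟩
    + p / q ℚ.* fromℕ y ℚ.* fromℕ q         ≡⟨ swap (+ p / q) (fromℕ y) (fromℕ q) ⟩
    + p / q ℚ.* fromℕ q ℚ.* fromℕ y         ≡⟨ cong (ℚ._* fromℕ y) (i/n*n≡i (+ p) q) ⟩
    fromℕ p ℚ.* fromℕ y                     ≡⟨ fromℕ-homo-* p y ⟨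
    fromℕ (p * y)                           ∎)
    where
    open ≡-Reasoning
    x≡p/q*y : fromℕ x ≡ + p / q ℚ.* fromℕ y
    x≡p/q*y = trans (sym (value*den≡num v))
      (cong (ℚ._* fromℕ y) (just-injective (trans (sym ([]ᶜᶠ≡value v)) as∷ʳa≡p/q)))
    swap : ∀ r y q → r ℚ.* y ℚ.* q ≡ r ℚ.* q ℚ.* y
    swap r y q = trans (ℚ.*-assoc r y q)
      (trans (cong (r ℚ.*_) (ℚ.*-comm y q)) (sym (ℚ.*-assoc r q y)))
  x≡p : x ≡ p
  x≡p = cross-coprime-≡ (num-den-coprime (as ∷ʳ a)) p⊥q xq≡py
  y≡q : y ≡ q
  y≡q = cross-coprime-≡ (Coprimality.sym (num-den-coprime (as ∷ʳ a))) (Coprimality.sym p⊥q)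
    (trans (ℕ.*-comm y p) (trans (sym xq≡py) (ℕ.*-comm x q)))
  den≡d : + den (palindrome as a) ≡ + p ℤ.* + q ℤ.+ -1ℤ ℤ.^ length (as ∷ʳ a)
  den≡d = trans (den-palindrome as a>0)
    (cong₂ (λ x y → + x ℤ.* + y ℤ.+ -1ℤ ℤ.^ length (as ∷ʳ a)) x≡p y≡q)
  -- The divisor is nonzero because it equals the positive denominator of the palindrome.
  d≢0 : ℚ.NonZero (fromℤ (+ p ℤ.* + q ℤ.+ -1ℤ ℤ.^ length (as ∷ʳ a)))
  d≢0 = subst (λ i → ℚ.NonZero (fromℤ i)) den≡d
    (≢-nonZero (fromℕ-≢0 (den (palindrome as a)) {{>-nonZero (++-den-pos as>0 a+1>0 tail-regular)}}))
  num≡p² : + num (palindrome as a) ≡ (+ p) ℤ.^ 2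
  num≡p² = begin
    + num (palindrome as a)   ≡⟨ cong +_ (num-palindrome as a>0) ⟩
    + (x * x)                 ≡⟨ cong (λ x → + (x * x)) x≡p ⟩
    + (p * p)                 ≡⟨ ℤ.pos-* p p ⟩
    -- The power unfolds to `+ p * (+ p * 1)`.
    + p ℤ.* + p               ≡⟨ cong (+ p ℤ.*_) (ℤ.*-identityʳ (+ p)) ⟨
    (+ p) ℤ.^ 2               ∎
    where open ≡-Reasoning
  w*d≡p² : value w ℚ.* fromℤ (+ p ℤ.* + q ℤ.+ -1ℤ ℤ.^ length (as ∷ʳ a)) ≡ fromℤ ((+ p) ℤ.^ 2)
  w*d≡p² = trans (cong (λ i → value w ℚ.* fromℤ i) (sym den≡d)) (trans (value*den≡num w) (cong fromℤ num≡p²))
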